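{- Consider the Normal Partizan Domination game on a star $K_{1,n}$ whose universal (center) vertex has color $A$, with $a$ leaves of color $A$, $b$ leaves of color $B$ and $c=n-a-b\geq 1$ leaves of color $C$. If $a=0$, the value is $(n-1)\cdot\uparrow$ if $n$ is even and $(n-1)\cdot\uparrow*$ if $n$ is odd. If $a>0$, the value is $J$ if $c$ is even and $J*$ if $c$ is odd, where $J$ is the value of the game on the star obtained by removing the $c$ leaves of color $C$ (keeping all other colors). If instead the universal vertex has color $B$, the value is $-J'$, where $J'$ is the value of the game obtained by interchanging the colors $A$ and $B$ on all vertices.
   Context: Normal Partizan Domination game: a finite graph $G$ has each vertex colored $A$, $B$ or $C$. Alice and Bob alternately select a vertex; Alice may only select vertices colored $A$ or $C$, Bob only vertices colored $B$ or $C$. A vertex $u$ dominates $v$ if $u=v$ or $uv$ is an edge. A vertex may be selected only if it is playable, i.e. it dominates at least one vertex not dominated by the previously selected vertices; the game ends when the selected vertices form a dominating set. Under normal play the player unable to move loses. The game is regarded as a partizan combinatorial game with Alice as Left and Bob as Right, and its value is its value in Conway's combinatorial game theory ($\{X\mid Y\}$ has Left options $X$ and Right options $Y$; $G+H$ is the disjunctive sum; $-G$ swaps Left and Right; $G=H$ iff $G+(-H)$ is a second-player win). Notation: $*=\{0\mid 0\}$; $\uparrow=\{0\mid *\}$; $m\cdot\uparrow$ is the sum of $m$ copies of $\uparrow$ (and $0\cdot\uparrow=0$); $J*$ denotes $J+*$. -}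

module Defs where

open import Data.Empty using (⊥; ⊥-elim)
open import Data.Fin.Base using (Fin; zero; suc)
open import Data.Fin.Subset as Subset using (Subset; _∈_; _∪_; ⁅_⁆; _⊃_)
open import Data.Fin.Subset.Induction using (⊃-wellFounded)
open import Data.Fin.Subset.Properties using (p⊆p∪q; q⊆p∪q; x∈⁅x⁆)
open import Data.List.Base using (List; length; lookup; filter)
open import Data.Nat.Base using (ℕ; zero; suc)
open import Data.Product.Base using (∃-syntax; _×_; _,_)
open import Data.Sum.Base using (_⊎_; [_,_])
open import Data.Unit.Base using (⊤; tt)
open import Function.Base using (_∘_)
open import Induction.WellFounded using (Acc; acc)
open import Level using (0ℓ)
open import Relation.Binary.Core using (Rel)
open import Relation.Binary.Definitions
  using (Decidable; DecidableEquality; Irreflexive; Symmetric)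
open import Relation.Binary.PropositionalEquality using (_≡_; refl)
open import Relation.Nullary using (¬_; yes; no)
open import Relation.Nullary.Decidable using (¬?)

------------------------------------------------------------------------
-- Partizan combinatorial games under normal play

data Game : Set₁ where
  node : (L R : Set) → (L → Game) → (R → Game) → Game

infixl 6 _⊕_
infix  8 ⊝_
infix  4 _≈_
infixl 7 _·_

⊝_ : Game → Game
⊝ node L R l r = node R L (λ j → ⊝ r j) (λ i → ⊝ l i)

_⊕_ : Game → Game → Game
G@(node L R l r) ⊕ H@(node L′ R′ l′ r′) = node (L ⊎ L′) (R ⊎ R′)
  [ (λ i → l i ⊕ H) , (λ i → G ⊕ l′ i) ]
  [ (λ j → r j ⊕ H) , (λ j → G ⊕ r′ j) ]

-- "Moving first" refers to the player making the next move.  A player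
-- without options loses.
LeftLosesMovingFirst RightWinsMovingFirst : Game → Set
LeftLosesMovingFirst (node L R l r) = ∀ i → RightWinsMovingFirst (l i)
RightWinsMovingFirst (node L R l r) = ∃[ j ] LeftLosesMovingFirst (r j)

RightLosesMovingFirst LeftWinsMovingFirst : Game → Set
RightLosesMovingFirst (node L R l r) = ∀ j → LeftWinsMovingFirst (r j)
LeftWinsMovingFirst   (node L R l r) = ∃[ i ] RightLosesMovingFirst (l i)

SecondPlayerWins : Game → Set
SecondPlayerWins G = LeftLosesMovingFirst G × RightLosesMovingFirst G

_≈_ : Rel Game 0ℓ
G ≈ H = SecondPlayerWins (G ⊕ ⊝ H)

𝟎 ⋆ ↑ : Game
𝟎 = node ⊥ ⊥ ⊥-elim ⊥-elim
⋆ = node ⊤ ⊤ (λ _ → 𝟎) (λ _ → 𝟎)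
↑ = node ⊤ ⊤ (λ _ → 𝟎) (λ _ → ⋆)

_·_ : ℕ → Game → Game
zero  · G = 𝟎
suc m · G = G ⊕ m · G

------------------------------------------------------------------------
-- Coloured finite simple graphs

record Graph (n : ℕ) : Set₁ where
  field
    Adj    : Rel (Fin n) 0ℓ
    sym    : Symmetric Adj
    irrefl : Irreflexive _≡_ Adj
    adj?   : Decidable Adj

data Color : Set where
  A B C : Color

_≟ᶜ_ : DecidableEquality Color
A ≟ᶜ A = yes refl
A ≟ᶜ B = no λ ()
A ≟ᶜ C = no λ ()
B ≟ᶜ A = no λ ()
B ≟ᶜ B = yes refl
B ≟ᶜ C = no λ ()
C ≟ᶜ A = no λ ()
C ≟ᶜ B = no λ ()
C ≟ᶜ C = yes refl

Coloring : ℕ → Set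
Coloring n = Fin n → Color

swapAB : Color → Color
swapAB A = B
swapAB B = A
swapAB C = C

------------------------------------------------------------------------
-- Normal Partizan Domination

AliceMay BobMay : Color → Set
AliceMay c = c ≡ A ⊎ c ≡ C
BobMay   c = c ≡ B ⊎ c ≡ C

module Domination {n : ℕ} (G : Graph n) (κ : Coloring n) where
  open Graph G using (Adj)

  Dominates : Rel (Fin n) 0ℓ
  Dominates u v = u ≡ v ⊎ Adj u v

  DominatedBy : Subset n → Fin n → Set
  DominatedBy S v = ∃[ u ] u ∈ S × Dominates u v

  Playable : Subset n → Fin n → Set
  Playable S u = ∃[ v ] Dominates u v × ¬ DominatedBy S v

  AliceMove BobMove : Subset n → Set
  AliceMove S = ∃[ u ] AliceMay (κ u) × Playable S u
  BobMove   S = ∃[ u ] BobMay   (κ u) × Playable S u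

  playable⇒⊃ : ∀ S u → Playable S u → (S ∪ ⁅ u ⁆) ⊃ S
  playable⇒⊃ S u (v , u▸v , ¬dom) =
    p⊆p∪q ⁅ u ⁆ , u , q⊆p∪q S ⁅ u ⁆ (x∈⁅x⁆ u) , λ u∈S → ¬dom (u , u∈S , u▸v)

  -- The game from the position in which the vertices of S have been
  -- selected.  When S is dominating no vertex is playable, so neither
  -- player has an option.
  position : (S : Subset n) → Acc _⊃_ S → Game
  position S (acc rs) = node (AliceMove S) (BobMove S)
    (λ (u , _ , p) → position (S ∪ ⁅ u ⁆) (rs (playable⇒⊃ S u p)))
    (λ (u , _ , p) → position (S ∪ ⁅ u ⁆) (rs (playable⇒⊃ S u p)))

  game : Game
  game = position Subset.⊥ (⊃-wellFounded Subset.⊥)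

dominationGame : ∀ {n} → Graph n → Coloring n → Game
dominationGame G κ = Domination.game G κ

------------------------------------------------------------------------
-- Stars

module _ (n : ℕ) where

  StarAdj : Rel (Fin (suc n)) 0ℓ
  StarAdj zero    zero    = ⊥
  StarAdj zero    (suc _) = ⊤
  StarAdj (suc _) zero    = ⊤
  StarAdj (suc _) (suc _) = ⊥

  private
    star-sym : Symmetric StarAdj
    star-sym {zero}  {suc _} _ = tt
    star-sym {suc _} {zero}  _ = tt

    star-irrefl : Irreflexive _≡_ StarAdj
    star-irrefl {zero}  refl ()
    star-irrefl {suc _} refl ()

    star-adj? : Decidable StarAdj
    star-adj? zero    zero    = no λ ()
    star-adj? zero    (suc _) = yes tt
    star-adj? (suc _) zero    = yes tt
    star-adj? (suc _) (suc _) = no λ ()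

  K₁ : Graph (suc n)
  K₁ = record
    { Adj    = StarAdj
    ; sym    = λ {u} {v} → star-sym {u} {v}
    ; irrefl = λ {u} {v} → star-irrefl {u} {v}
    ; adj?   = star-adj?
    }

-- The list gives the colours of the leaves.
starColoring : Color → (leaves : List Color) → Coloring (suc (length leaves))
starColoring center leaves zero    = center
starColoring center leaves (suc i) = lookup leaves i

starGame : Color → List Color → Game
starGame center leaves =
  dominationGame (K₁ (length leaves)) (starColoring center leaves)

swappedStarGame : Color → List Color → Game
swappedStarGame center leaves =
  dominationGame (K₁ (length leaves)) (swapAB ∘ starColoring center leaves)

#[_] : Color → List Color → ℕ
#[ c ] leaves = length (filter (c ≟ᶜ_) leaves)

removeC : List Color → List Color
removeC = filter (λ c → ¬? (C ≟ᶜ c))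

-- Every game involved is described by a small transition system: an unfinished
-- star position by the numbers (a, b, c) of unselected leaves of each colour, a
-- finished one by (0, 0, 0), and a sum of k copies of ↑ and e copies of ⋆ by
-- (k, e).  A player moving second wins as soon as some set of states is closed
-- under "any move of the opponent, then a suitable reply".
--
-- For a = 0, comparing the star with k · ↑ + e · ⋆, these sets are read off the
-- expected value of the difference, which depends only on b + c, k and e.  For
-- a > 0, comparing the star with J + e · ⋆, the replies keep a and b equal on
-- both sides and c + e even.  This fails only when the A-leaves run out on one
-- side or the centre is taken; then one side is an infinitesimal, and the other
-- side still has an A-leaf, whose owner can wait until taking its centre is the
-- last move of the game.

module Submission where

open import Defs
open import Data.Empty using (⊥-elim)
open import Data.Fin.Base using (Fin; zero; suc)
open import Data.Fin.Subset as Subset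
  using (Subset; _∉_; _∪_; ⁅_⁆; _⊃_; inside; outside)
open import Data.Fin.Subset.Induction using (⊃-wellFounded)
open import Data.Fin.Subset.Properties using (∪-identityʳ)
open import Data.List.Base using (List; []; _∷_; length; lookup)
open import Data.Nat.Base using (ℕ; zero; suc; _+_; _∸_; _≤_; _≥_; _>_; z≤n; s≤s)
open import Data.Nat.Divisibility
  using (_∣_; _∤_; ∣-refl; _∣0; ∣m∣n⇒∣m+n; ∣m+n∣m⇒∣n; ∣1⇒≡1)
open import Data.Nat.Properties
  using (≤-refl; ≤-trans; n≤1+n; m≤n⇒m≤1+n; m∸n≤m; ∸-monoˡ-≤
        ; +-suc; +-comm; +-identityʳ; m≤n+m∸n; m+n≡0⇒m≡0)
open import Data.Product.Base using (∃-syntax; Σ-syntax; _×_; _,_; proj₁; proj₂)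
open import Data.Sum.Base using (_⊎_; inj₁; inj₂; [_,_])
open import Data.Vec.Base using ([]; _∷_; here; there)
open import Function.Base using (_∘_)
open import Induction.WellFounded using (Acc; acc)
open import Relation.Binary.PropositionalEquality
  using (_≡_; _≢_; refl; sym; trans; cong; subst)
open import Relation.Nullary using (¬_; yes; no; contradiction)

-- Transition systems and the games they describe

record System : Set₁ where
  infix 4 _⟶ᴸ_ _⟶ᴿ_
  field
    State     : Set
    _⟶ᴸ_ _⟶ᴿ_ : State → State → Set

module _ (𝓢 : System) where
  open System 𝓢

  -- A bisimulation, with a forth and a back clause for each player. Distinct positions may share a
  -- state, so a strategy can be described on the counts that matter.
  Models : Game → State → Set
  Models (node L R l r) s =
      (∀ i → ∃[ t ] s ⟶ᴸ t × Models (l i) t)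
    × (∀ {t} → s ⟶ᴸ t → ∃[ i ] Models (l i) t)
    × (∀ j → ∃[ t ] s ⟶ᴿ t × Models (r j) t)
    × (∀ {t} → s ⟶ᴿ t → ∃[ j ] Models (r j) t)

  RightReplies LeftReplies : (State → Set) → State → Set
  RightReplies P s = ∃[ t ] s ⟶ᴿ t × P t
  LeftReplies  P s = ∃[ t ] s ⟶ᴸ t × P t


  module _ (P : State → Set) (reply : ∀ {s t} → P s → s ⟶ᴸ t → RightReplies P t) where
    mutual
      -- Left is to move at the states of `P`, and `reply` is Right's strategy. Termination comes
      -- from descending the game tree, not from a measure on states.
      leftLoses : ∀ G {s} → Models G s → P s → LeftLosesMovingFirst G
      leftLoses (node _ _ l _) (fromL , _) Ps i =
        let _ , s⟶t , M = fromL i in rightWins (l i) M (reply Ps s⟶t)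

      rightWins : ∀ G {s} → Models G s → RightReplies P s → RightWinsMovingFirst G
      rightWins (node _ _ _ r) (_ , _ , _ , toR) (_ , s⟶t , Pt) =
        let j , M = toR s⟶t in j , leftLoses (r j) M Pt

  module _ (P : State → Set) (reply : ∀ {s t} → P s → s ⟶ᴿ t → LeftReplies P t) where
    mutual
      rightLoses : ∀ G {s} → Models G s → P s → RightLosesMovingFirst G
      rightLoses (node _ _ _ r) (_ , _ , fromR , _) Ps j =
        let _ , s⟶t , M = fromR j in leftWins (r j) M (reply Ps s⟶t)

      leftWins : ∀ G {s} → Models G s → LeftReplies P s → LeftWinsMovingFirst G
      leftWins (node _ _ l _) (_ , toL , _) (_ , s⟶t , Pt) =
        let i , M = toL s⟶t in i , rightLoses (l i) M Pt

-- Negatives, sums and maps of transition systems.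

infixl 6 _⊕ˢ_
infix  8 ⊝ˢ_

⊝ˢ_ : System → System
⊝ˢ 𝓢 = record { State = State ; _⟶ᴸ_ = _⟶ᴿ_ ; _⟶ᴿ_ = _⟶ᴸ_ }
  where open System 𝓢

data InOne {S T : Set} (_⟶₁_ : S → S → Set) (_⟶₂_ : T → T → Set) : S × T → S × T → Set where
  fst : ∀ {s s′ t} → s ⟶₁ s′ → InOne _⟶₁_ _⟶₂_ (s , t) (s′ , t)
  snd : ∀ {s t t′} → t ⟶₂ t′ → InOne _⟶₁_ _⟶₂_ (s , t) (s , t′)

caseInOne : ∀ {S T : Set} {_⟶₁_ : S → S → Set} {_⟶₂_ : T → T → Set} {s t} (P : S × T → Set) →
            (∀ {s′} → s ⟶₁ s′ → P (s′ , t)) → (∀ {t′} → t ⟶₂ t′ → P (s , t′)) →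
            ∀ {u} → InOne _⟶₁_ _⟶₂_ (s , t) u → P u
caseInOne P onFst onSnd (fst m) = onFst m
caseInOne P onFst onSnd (snd m) = onSnd m

_⊕ˢ_ : System → System → System
𝓢 ⊕ˢ 𝓣 = record
  { State = 𝓢.State × 𝓣.State
  ; _⟶ᴸ_  = InOne 𝓢._⟶ᴸ_ 𝓣._⟶ᴸ_
  ; _⟶ᴿ_  = InOne 𝓢._⟶ᴿ_ 𝓣._⟶ᴿ_
  }
  where
  module 𝓢 = System 𝓢
  module 𝓣 = System 𝓣

models-⊝ : ∀ 𝓢 G {s} → Models 𝓢 G s → Models (⊝ˢ 𝓢) (⊝ G) s
models-⊝ 𝓢 (node _ _ l r) (fromL , toL , fromR , toR) =
    (λ j → let t , m , M = fromR j in t , m , models-⊝ 𝓢 (r j) M)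
  , (λ m → let j , M = toR m in j , models-⊝ 𝓢 (r j) M)
  , (λ i → let t , m , M = fromL i in t , m , models-⊝ 𝓢 (l i) M)
  , (λ m → let i , M = toL m in i , models-⊝ 𝓢 (l i) M)

module _ (𝓢 𝓣 : System) where

  models-⊕ : ∀ G H {s t} → Models 𝓢 G s → Models 𝓣 H t → Models (𝓢 ⊕ˢ 𝓣) (G ⊕ H) (s , t)
  models-⊕ G@(node _ _ l r) H@(node _ _ l′ r′)
           M@(fromL , toL , fromR , toR) N@(fromL′ , toL′ , fromR′ , toR′) =
      [ (λ i → let _ , m , M′ = fromL i  in _ , fst m , models-⊕ (l i) H M′ N)
      , (λ i → let _ , m , N′ = fromL′ i in _ , snd m , models-⊕ G (l′ i) M N′) ]
    , caseInOne (λ u → ∃[ i ] Models (𝓢 ⊕ˢ 𝓣) ([ (λ i → l i ⊕ H) , (λ i → G ⊕ l′ i) ] i) u)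
        (λ m → let i , M′ = toL m  in inj₁ i , models-⊕ (l i) H M′ N)
        (λ m → let i , N′ = toL′ m in inj₂ i , models-⊕ G (l′ i) M N′)
    , [ (λ j → let _ , m , M′ = fromR j  in _ , fst m , models-⊕ (r j) H M′ N)
      , (λ j → let _ , m , N′ = fromR′ j in _ , snd m , models-⊕ G (r′ j) M N′) ]
    , caseInOne (λ u → ∃[ j ] Models (𝓢 ⊕ˢ 𝓣) ([ (λ j → r j ⊕ H) , (λ j → G ⊕ r′ j) ] j) u)
        (λ m → let j , M′ = toR m  in inj₁ j , models-⊕ (r j) H M′ N)
        (λ m → let j , N′ = toR′ m in inj₂ j , models-⊕ G (r′ j) M N′)

module _ (𝓢 𝓣 : System) where
  private
    module 𝓢 = System 𝓢
    module 𝓣 = System 𝓣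

  -- A functional bisimulation: moves go forward along `f`, and every move out of an image lifts
  -- back. It merges the two components of a sum of `Ups` and, in the final theorem, adjoins an
  -- empty `Ups` component.
  models-map : (f : 𝓢.State → 𝓣.State) →
               (∀ {s s′} → s 𝓢.⟶ᴸ s′ → f s 𝓣.⟶ᴸ f s′) →
               (∀ s {t} → f s 𝓣.⟶ᴸ t → ∃[ s′ ] s 𝓢.⟶ᴸ s′ × f s′ ≡ t) →
               (∀ {s s′} → s 𝓢.⟶ᴿ s′ → f s 𝓣.⟶ᴿ f s′) →
               (∀ s {t} → f s 𝓣.⟶ᴿ t → ∃[ s′ ] s 𝓢.⟶ᴿ s′ × f s′ ≡ t) →
               ∀ G {s} → Models 𝓢 G s → Models 𝓣 G (f s)
  models-map f f-L f-L⁻¹ f-R f-R⁻¹ = go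
    where
    go : ∀ G {s} → Models 𝓢 G s → Models 𝓣 G (f s)
    go (node _ _ l r) {s} (fromL , toL , fromR , toR) =
        (λ i → let _ , m , M = fromL i in _ , f-L m , go (l i) M)
      , (λ m → let _ , m′ , eq = f-L⁻¹ s m
                   i , M = toL m′
               in i , subst (Models 𝓣 (l i)) eq (go (l i) M))
      , (λ j → let _ , m , M = fromR j in _ , f-R m , go (r j) M)
      , (λ m → let _ , m′ , eq = f-R⁻¹ s m
                   j , M = toR m′
               in j , subst (Models 𝓣 (r j)) eq (go (r j) M))

-- Sums of copies of ↑ and ⋆

-- Here `e` counts copies of `⋆` instead of recording their parity: the model has to match the game
-- tree move for move, and cancelling pairs would change it.
data UpMoveᴸ : ℕ × ℕ → ℕ × ℕ → Set where
  up   : ∀ {k e} → UpMoveᴸ (suc k , e) (k , e)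
  star : ∀ {k e} → UpMoveᴸ (k , suc e) (k , e)

data UpMoveᴿ : ℕ × ℕ → ℕ × ℕ → Set where
  up   : ∀ {k e} → UpMoveᴿ (suc k , e) (k , suc e)
  star : ∀ {k e} → UpMoveᴿ (k , suc e) (k , e)

Ups : System
Ups = record { State = ℕ × ℕ ; _⟶ᴸ_ = UpMoveᴸ ; _⟶ᴿ_ = UpMoveᴿ }

add : (ℕ × ℕ) × (ℕ × ℕ) → ℕ × ℕ
add ((k , e) , (k′ , e′)) = k + k′ , e + e′

models-𝟎 : Models Ups 𝟎 (0 , 0)
models-𝟎 = (λ ()) , (λ ()) , (λ ()) , (λ ())

models-⋆ : Models Ups ⋆ (0 , 1)
models-⋆ = (λ _ → _ , star , models-𝟎) , (λ { star → _ , models-𝟎 })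
         , (λ _ → _ , star , models-𝟎) , (λ { star → _ , models-𝟎 })

models-↑ : Models Ups ↑ (1 , 0)
models-↑ = (λ _ → _ , up , models-𝟎) , (λ { up → _ , models-𝟎 })
         , (λ _ → _ , up , models-⋆) , (λ { up → _ , models-⋆ })

upᴸ-+ : ∀ {s s′} → System._⟶ᴸ_ (Ups ⊕ˢ Ups) s s′ → UpMoveᴸ (add s) (add s′)
upᴸ-+ (fst up)   = up
upᴸ-+ (fst star) = star
upᴸ-+ {(k , e) , _} (snd (up {k′}))       rewrite +-suc k k′ = up
upᴸ-+ {(k , e) , _} (snd (star {e = e′})) rewrite +-suc e e′ = star

upᴸ-+⁻¹ : ∀ s {t} → UpMoveᴸ (add s) t → ∃[ s′ ] System._⟶ᴸ_ (Ups ⊕ˢ Ups) s s′ × add s′ ≡ t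
-- `add` reduces when the first summand is empty, so `m` is already a move of the second.
upᴸ-+⁻¹ ((zero , zero) , _) m = _ , snd m , refl
upᴸ-+⁻¹ ((zero , suc e) , (suc k , _)) up = _ , snd up , refl
upᴸ-+⁻¹ ((zero , suc e) , _) star = _ , fst star , refl
upᴸ-+⁻¹ ((suc k , zero) , _) up = _ , fst up , refl
upᴸ-+⁻¹ ((suc k , zero) , (_ , suc e)) star = _ , snd star , refl
upᴸ-+⁻¹ ((suc k , suc e) , _) up = _ , fst up , refl
upᴸ-+⁻¹ ((suc k , suc e) , _) star = _ , fst star , refl

upᴿ-+ : ∀ {s s′} → System._⟶ᴿ_ (Ups ⊕ˢ Ups) s s′ → UpMoveᴿ (add s) (add s′)
upᴿ-+ (fst up)   = up
upᴿ-+ (fst star) = star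
upᴿ-+ {(k , e) , _} (snd (up {k′} {e′}))  rewrite +-suc k k′ | +-suc e e′ = up
upᴿ-+ {(k , e) , _} (snd (star {e = e′})) rewrite +-suc e e′ = star

upᴿ-+⁻¹ : ∀ s {t} → UpMoveᴿ (add s) t → ∃[ s′ ] System._⟶ᴿ_ (Ups ⊕ˢ Ups) s s′ × add s′ ≡ t
upᴿ-+⁻¹ ((zero , zero) , _) m = _ , snd m , refl
upᴿ-+⁻¹ ((zero , suc e) , (suc k , e′)) up = _ , snd up , cong (k ,_) (+-suc (suc e) e′)
upᴿ-+⁻¹ ((zero , suc e) , _) star = _ , fst star , refl
upᴿ-+⁻¹ ((suc k , zero) , _) up = _ , fst up , refl
upᴿ-+⁻¹ ((suc k , zero) , (_ , suc e)) star = _ , snd star , refl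
upᴿ-+⁻¹ ((suc k , suc e) , _) up = _ , fst up , refl
upᴿ-+⁻¹ ((suc k , suc e) , _) star = _ , fst star , refl

models-+ : ∀ G H {s t} → Models Ups G s → Models Ups H t → Models Ups (G ⊕ H) (add (s , t))
models-+ G H M N =
  models-map (Ups ⊕ˢ Ups) Ups add upᴸ-+ upᴸ-+⁻¹ upᴿ-+ upᴿ-+⁻¹ (G ⊕ H) (models-⊕ Ups Ups G H M N)

models-· : ∀ k → Models Ups (k · ↑) (k , 0)
models-· zero    = models-𝟎
models-· (suc k) = models-+ ↑ (k · ↑) models-↑ (models-· k)

models-·⊕⋆ : ∀ k → Models Ups (k · ↑ ⊕ ⋆) (k , 1)
models-·⊕⋆ k =
  subst (λ m → Models Ups (k · ↑ ⊕ ⋆) (m , 1)) (+-identityʳ k) (models-+ (k · ↑) ⋆ (models-· k) models-⋆)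

-- Parity

mutual
  -- Inductive parity lets the change caused by one move be read off by matching a constructor.
  data Even : ℕ → Set where
    zero : Even zero
    suc  : ∀ {n} → Odd n → Even (suc n)

  data Odd : ℕ → Set where
    suc : ∀ {n} → Even n → Odd (suc n)

even⊎odd : ∀ n → Even n ⊎ Odd n
even⊎odd zero    = inj₁ zero
even⊎odd (suc n) with even⊎odd n
... | inj₁ e = inj₂ (suc e)
... | inj₂ o = inj₁ (suc o)

even-pred : ∀ {n} → Even (suc n) → Odd n
even-pred (suc o) = o

odd-pred : ∀ {n} → Odd (suc n) → Even n
odd-pred (suc e) = e

odd+even⇒odd : ∀ {m n} → Odd (m + n) → Even n → Odd m
odd+even⇒odd {m} o zero rewrite +-identityʳ m = o
odd+even⇒odd {m} o (suc {n} (suc {k} e)) rewrite +-suc m (suc k) | +-suc m k =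
  odd+even⇒odd (even-pred (odd-pred o)) e

mutual
  even⇒2∣ : ∀ {n} → Even n → 2 ∣ n
  even⇒2∣ zero          = 2 ∣0
  even⇒2∣ (suc (suc e)) = ∣m∣n⇒∣m+n ∣-refl (even⇒2∣ e)

  odd⇒2∤ : ∀ {n} → Odd n → 2 ∤ n
  odd⇒2∤ (suc zero) 2∣1 with () ← ∣1⇒≡1 2∣1
  odd⇒2∤ (suc (suc o)) 2∣n = odd⇒2∤ o (∣m+n∣m⇒∣n 2∣n ∣-refl)

2∣⇒even : ∀ {n} → 2 ∣ n → Even n
2∣⇒even {n} 2∣n with even⊎odd n
... | inj₁ e = e
... | inj₂ o = contradiction 2∣n (odd⇒2∤ o)

2∤⇒odd : ∀ {n} → 2 ∤ n → Odd n
2∤⇒odd {n} 2∤n with even⊎odd n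
... | inj₁ e = contradiction (even⇒2∣ e) 2∤n
... | inj₂ o = o

-- Stars with a centre of colour A

Counts : Set
Counts = ℕ × ℕ × ℕ

ended : Counts
ended = 0 , 0 , 0

-- The centre is playable exactly while some leaf is undominated. Selecting the centre and
-- exhausting the leaves both finish the game, hence the single state `ended`.
data StarMoveᴸ : Counts → Counts → Set where
  centre : ∀ {s} → s ≢ ended → StarMoveᴸ s ended
  leafA  : ∀ {a b c} → StarMoveᴸ (suc a , b , c) (a , b , c)
  leafC  : ∀ {a b c} → StarMoveᴸ (a , b , suc c) (a , b , c)

data StarMoveᴿ : Counts → Counts → Set where
  leafB : ∀ {a b c} → StarMoveᴿ (a , suc b , c) (a , b , c)
  leafC : ∀ {a b c} → StarMoveᴿ (a , b , suc c) (a , b , c)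

Star : System
Star = record { State = Counts ; _⟶ᴸ_ = StarMoveᴸ ; _⟶ᴿ_ = StarMoveᴿ }

-- Without A-leaves: comparison with k · ↑ + e · ⋆

StarVsUps : System
StarVsUps = Star ⊕ˢ ⊝ˢ Ups

-- With n = b + c leaves left, the value of the state is
-- ((n ∸ 1) ∸ k) · ↑ (to be read with signs) plus ⋆ exactly if n + e is odd.
-- The finished star n = 0 has value 0, as this formula predicts thanks to
-- truncated subtraction.

LeftLosing RightWinning RightLosing LeftWinning : (n k e : ℕ) → Set
LeftLosing   n k e = (n ∸ 1 ≤ k × Even (n + e)) ⊎ (2 + (n ∸ 1) ≤ k)
RightWinning n k e = (n ∸ 1 ≤ suc k × Odd (n + e)) ⊎ (suc (n ∸ 1) ≤ k)
RightLosing  n k e = (k ≤ n ∸ 1 × Even (n + e)) ⊎ (2 + k ≤ n ∸ 1)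
LeftWinning  n k e = (k ≤ suc (n ∸ 1) × Odd (n + e)) ⊎ (suc k ≤ n ∸ 1)

-- The thresholds in the four predicates reflect that `↑ ⊕ ⋆` is confused with `𝟎` while `2 · ↑ ⊕ ⋆`
-- is positive: in the presence of a `⋆`, two copies of `↑` settle the sign.
data OnState (P : ℕ → ℕ → ℕ → Set) : Counts × (ℕ × ℕ) → Set where
  on : ∀ {b c k e} → P (b + c) k e → OnState P ((0 , b , c) , (k , e))

rightWinning⇒≤ : ∀ {n k e} → RightWinning n k e → n ∸ 1 ≤ suc k
rightWinning⇒≤ (inj₁ (n≤k , _)) = n≤k
rightWinning⇒≤ (inj₂ n<k)       = m≤n⇒m≤1+n (≤-trans (n≤1+n _) n<k)

-- If `n + e` is even, Right replaces a negated `↑` by `𝟎`. If it is odd, Right repairs the parity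
-- with a leaf, which also lowers `n ∸ 1` when `n` is at least two; a `⋆` is used only once the star
-- is finished.
rightReply : ∀ b c k e → RightWinning (b + c) k e →
             RightReplies StarVsUps (OnState LeftLosing) ((0 , b , c) , (k , e))
rightReply b c k e w with even⊎odd (b + c + e)
rightReply b c (suc k) e (inj₂ (s≤s n≤k)) | inj₁ ev = _ , snd up , on (inj₁ (n≤k , ev))
rightReply b c k e (inj₁ (_ , od)) | inj₁ ev = contradiction (even⇒2∣ ev) (odd⇒2∤ od)
rightReply zero zero k (suc e) w | inj₂ od = _ , snd star , on (inj₁ (z≤n , odd-pred od))
rightReply zero (suc c) k e w | inj₂ od =
  _ , fst leafC , on (inj₁ (∸-monoˡ-≤ 1 (rightWinning⇒≤ {suc c} w) , odd-pred od))
rightReply (suc b) c k e w | inj₂ od =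
  _ , fst leafB , on (inj₁ (∸-monoˡ-≤ 1 (rightWinning⇒≤ {suc (b + c)} w) , odd-pred od))

leftLosing-closed : ∀ {s t} → OnState LeftLosing s → System._⟶ᴸ_ StarVsUps s t →
                    RightReplies StarVsUps (OnState LeftLosing) t
leftLosing-closed (on {b} {c} {k} {e} p) (fst (centre s≢)) = rightReply 0 0 k e (after (b + c) n≢0 p)
  where
  n≢0 : b + c ≢ 0
  n≢0 n≡0 with refl ← m+n≡0⇒m≡0 b n≡0 | refl ← n≡0 = s≢ refl

  after : ∀ n → n ≢ 0 → LeftLosing n k e → RightWinning 0 k e
  -- Ending a star with one leaf leaves `n ∸ 1` at zero and only flips the parity. With more leaves
  -- `k` is at least one, and the remaining negated copies of `↑` favour Right.
  after zero          n≢0 _                       = contradiction refl n≢0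
  after (suc zero)    _   (inj₁ (_ , ev))         = inj₁ (z≤n , even-pred ev)
  after (suc (suc _)) _   (inj₁ (s≤s _ , _))      = inj₂ (s≤s z≤n)
  after (suc _)       _   (inj₂ (s≤s (s≤s _)))    = inj₂ (s≤s z≤n)
leftLosing-closed (on {b} {suc c} {k} {e} p) (fst leafC) rewrite +-suc b c =
  rightReply b c k e (after p)
  where
  after : LeftLosing (suc (b + c)) k e → RightWinning (b + c) k e
  after (inj₁ (n≤k , ev)) = inj₁ (≤-trans (m∸n≤m (b + c) 1) (m≤n⇒m≤1+n n≤k) , even-pred ev)
  after (inj₂ n≤k)        = inj₂ (≤-trans (s≤s (m∸n≤m (b + c) 1)) (≤-trans (n≤1+n _) n≤k))
leftLosing-closed (on {b} {c} {suc k} {e} p) (snd up) = rightReply b c k (suc e) (after p)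
  where
  after : LeftLosing (b + c) (suc k) e → RightWinning (b + c) k (suc e)
  after (inj₁ (n≤k , ev)) = inj₁ (n≤k , subst Odd (sym (+-suc (b + c) e)) (suc ev))
  after (inj₂ (s≤s n≤k))  = inj₂ n≤k
leftLosing-closed (on {b} {c} {k} {suc e} p) (snd star) = rightReply b c k e (after p)
  where
  after : LeftLosing (b + c) k (suc e) → RightWinning (b + c) k e
  after (inj₁ (n≤k , ev)) = inj₁ (m≤n⇒m≤1+n n≤k , even-pred (subst Even (+-suc (b + c) e) ev))
  after (inj₂ n≤k)        = inj₂ (≤-trans (n≤1+n _) n≤k)

-- While `k` is positive, Left turns a negated `↑` into a `⋆`, which drops `k` and flips the parity
-- at once. When `k` is zero, Left takes the centre if `e` is even and a `⋆` if `e` is odd, so that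
-- an even number of copies of `⋆` remains.
leftReply : ∀ b c k e → LeftWinning (b + c) k e →
            LeftReplies StarVsUps (OnState RightLosing) ((0 , b , c) , (k , e))
leftReply b c (suc k) e w = _ , snd up , on (after w)
  where
  after : LeftWinning (b + c) (suc k) e → RightLosing (b + c) k (suc e)
  after (inj₁ (s≤s k≤n , od)) = inj₁ (k≤n , subst Even (sym (+-suc (b + c) e)) (suc od))
  after (inj₂ k<n)            = inj₂ k<n
leftReply b c zero e w with even⊎odd e
... | inj₁ ev = _ , fst (centre (nonempty w)) , on (inj₁ (z≤n , ev))
  where
  nonempty : ∀ {b c} → LeftWinning (b + c) zero e → (0 , b , c) ≢ ended
  nonempty (inj₁ (_ , od)) refl = odd⇒2∤ od (even⇒2∣ ev)
  nonempty (inj₂ ())       refl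
... | inj₂ (suc {e′} ev) = _ , snd star , on (after (b + c) w)
  where
  after : ∀ n → LeftWinning n zero (suc e′) → RightLosing n zero e′
  after n (inj₁ (_ , od)) = inj₁ (z≤n , odd-pred (subst Odd (+-suc n e′) od))
  after n (inj₂ 0<n) with even⊎odd (n + e′)
  ... | inj₁ ev′ = inj₁ (z≤n , ev′)
  -- Now `n` is odd and at least two, hence at least three: this is the second clause of
  -- `RightLosing`.
  ... | inj₂ od  with odd+even⇒odd {n} od ev
  after (suc (suc (suc _))) (inj₂ _) | inj₂ _ | _ = inj₂ (s≤s (s≤s z≤n))
  after (suc (suc zero)) (inj₂ _) | inj₂ _ | suc (suc ())
  after (suc zero) (inj₂ ()) | inj₂ _ | _

rightLosing-leaf : ∀ {n k e} → RightLosing (suc n) k e → LeftWinning n k e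
rightLosing-leaf {n} (inj₁ (k≤n , ev)) = inj₁ (≤-trans k≤n (m≤n+m∸n n 1) , even-pred ev)
rightLosing-leaf     (inj₂ k<n)        = inj₂ (∸-monoˡ-≤ 1 k<n)

rightLosing-closed : ∀ {s t} → OnState RightLosing s → System._⟶ᴿ_ StarVsUps s t →
                     LeftReplies StarVsUps (OnState RightLosing) t
rightLosing-closed (on {suc b} {c} p) (fst leafB) = leftReply b c _ _ (rightLosing-leaf p)
rightLosing-closed (on {b} {suc c} p) (fst leafC) rewrite +-suc b c =
  leftReply b c _ _ (rightLosing-leaf p)
rightLosing-closed (on {b} {c} {suc k} {e} p) (snd up) = leftReply b c k e (after p)
  where
  after : RightLosing (b + c) (suc k) e → LeftWinning (b + c) k e
  after (inj₁ (k<n , _)) = inj₂ k<n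
  after (inj₂ k<n)       = inj₂ (≤-trans (n≤1+n _) (≤-trans (n≤1+n _) k<n))
rightLosing-closed (on {b} {c} {k} {suc e} p) (snd star) = leftReply b c k e (after p)
  where
  after : RightLosing (b + c) k (suc e) → LeftWinning (b + c) k e
  after (inj₁ (k≤n , ev)) = inj₁ (m≤n⇒m≤1+n k≤n , even-pred (subst Even (+-suc (b + c) e) ev))
  after (inj₂ k<n)        = inj₂ (≤-trans (n≤1+n _) k<n)

starVsUps≈ : ∀ G H {b c k e} → Models Star G (0 , b , c) → Models Ups H (k , e) →
             k ≡ (b + c) ∸ 1 → Even (b + c + e) → G ≈ H
starVsUps≈ G H M N refl ev =
    leftLoses  StarVsUps (OnState LeftLosing)  leftLosing-closed  (G ⊕ ⊝ H) M′ (on (inj₁ (≤-refl , ev)))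
  , rightLoses StarVsUps (OnState RightLosing) rightLosing-closed (G ⊕ ⊝ H) M′ (on (inj₁ (≤-refl , ev)))
  where M′ = models-⊕ Star (⊝ˢ Ups) G (⊝ H) M (models-⊝ Ups H N)

-- With A-leaves: comparison with J + e · ⋆

StarVsStar : System
StarVsStar = Star ⊕ˢ ⊝ˢ (Star ⊕ˢ Ups)

diff : Counts → Counts → ℕ → System.State StarVsStar
diff s t e = s , t , 0 , e

-- `tiny` includes a finished first star, so it covers both ways of leaving `balanced`: Left takes
-- the last `A`-leaf or the centre.
data LeftLosing′ : System.State StarVsStar → Set where
  balanced : ∀ {a b c e} → Even (c + e) → LeftLosing′ (diff (suc a , b , c) (suc a , b , 0) e)
  tiny     : ∀ {a b c b′ c′ e} → LeftLosing′ (diff (0 , b , c) (suc a , b′ , c′) e)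
  over     : LeftLosing′ (diff ended ended 0)

data RightLosing′ : System.State StarVsStar → Set where
  balanced : ∀ {a b c e} → Even (c + e) → RightLosing′ (diff (suc a , b , c) (suc a , b , 0) e)
  huge     : ∀ {a b c b′ c′ e} → RightLosing′ (diff (suc a , b , c) (0 , b′ , c′) e)
  over     : RightLosing′ (diff ended ended 0)

-- Left cannot touch the `A`-leaves of the negated star. Right therefore plays elsewhere as long as
-- possible and then takes that star's centre, which ends everything whatever `b′` and `c′` are.
tinyReply : ∀ {a b′ c′} b c e →
            RightReplies StarVsStar LeftLosing′ (diff (0 , b , c) (suc a , b′ , c′) e)
tinyReply b       c       (suc e) = _ , snd (snd star) , tiny
tinyReply (suc b) c       zero    = _ , fst leafB , tiny
tinyReply zero    (suc c) zero    = _ , fst leafC , tiny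
tinyReply zero    zero    zero    = _ , snd (fst (centre λ ())) , over

hugeReply : ∀ {a b c} b′ c′ e →
            LeftReplies StarVsStar RightLosing′ (diff (suc a , b , c) (0 , b′ , c′) e)
hugeReply b       c       (suc e) = _ , snd (snd star) , huge
hugeReply (suc b) c       zero    = _ , snd (fst leafB) , huge
hugeReply zero    (suc c) zero    = _ , snd (fst leafC) , huge
hugeReply zero    zero    zero    = _ , fst (centre λ ()) , over

-- A `C`-leaf acts as a `⋆` here: either player may remove it. Oddness of `c + e` guarantees that
-- one of the two is left to answer with.
rightRebalances : ∀ {a b} c e → Odd (c + e) →
                  RightReplies StarVsStar LeftLosing′ (diff (suc a , b , c) (suc a , b , 0) e)
rightRebalances zero    (suc e) (suc ev) = _ , snd (snd star) , balanced ev
rightRebalances (suc c) e       (suc ev) = _ , fst leafC , balanced ev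

leftRebalances : ∀ {a b} c e → Odd (c + e) →
                 LeftReplies StarVsStar RightLosing′ (diff (suc a , b , c) (suc a , b , 0) e)
leftRebalances zero    (suc e) (suc ev) = _ , snd (snd star) , balanced ev
leftRebalances (suc c) e       (suc ev) = _ , fst leafC , balanced ev

leftLosing′-closed : ∀ {s t} → LeftLosing′ s → System._⟶ᴸ_ StarVsStar s t →
                     RightReplies StarVsStar LeftLosing′ t
leftLosing′-closed (balanced ev)         (fst (centre _))  = tinyReply 0 0 _
-- Copying would use up the last `A`-leaf on Right's side; Right keeps it and switches to
-- `tinyReply`.
leftLosing′-closed (balanced {zero} ev)  (fst leafA)       = tinyReply _ _ _
leftLosing′-closed (balanced {suc a} ev) (fst leafA)       = _ , snd (fst leafA) , balanced ev
leftLosing′-closed (balanced (suc od))   (fst leafC)       = rightRebalances _ _ od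
leftLosing′-closed (balanced ev)         (snd (fst leafB)) = _ , fst leafB , balanced ev
leftLosing′-closed (balanced {c = c} {suc e} ev) (snd (snd star)) =
  rightRebalances c e (even-pred (subst Even (+-suc c e) ev))
leftLosing′-closed tiny (fst (centre _))  = tinyReply 0 0 _
leftLosing′-closed tiny (fst leafC)       = tinyReply _ _ _
leftLosing′-closed tiny (snd (fst leafB)) = tinyReply _ _ _
leftLosing′-closed tiny (snd (fst leafC)) = tinyReply _ _ _
leftLosing′-closed tiny (snd (snd star))  = tinyReply _ _ _
leftLosing′-closed over (fst (centre ¬ended)) = contradiction refl ¬ended
leftLosing′-closed over (snd (fst ()))
leftLosing′-closed over (snd (snd ()))

rightLosing′-closed : ∀ {s t} → RightLosing′ s → System._⟶ᴿ_ StarVsStar s t →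
                      LeftReplies StarVsStar RightLosing′ t
rightLosing′-closed (balanced ev)         (fst leafB)            = _ , snd (fst leafB) , balanced ev
rightLosing′-closed (balanced (suc od))   (fst leafC)            = leftRebalances _ _ od
rightLosing′-closed (balanced ev)         (snd (fst (centre _))) = hugeReply 0 0 _
rightLosing′-closed (balanced {zero} ev)  (snd (fst leafA))      = hugeReply _ _ _
rightLosing′-closed (balanced {suc a} ev) (snd (fst leafA))      = _ , fst leafA , balanced ev
rightLosing′-closed (balanced {c = c} {suc e} ev) (snd (snd star)) =
  leftRebalances c e (even-pred (subst Even (+-suc c e) ev))
rightLosing′-closed huge (fst leafB)            = hugeReply _ _ _
rightLosing′-closed huge (fst leafC)            = hugeReply _ _ _
rightLosing′-closed huge (snd (fst (centre _))) = hugeReply 0 0 _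
rightLosing′-closed huge (snd (fst leafC))      = hugeReply _ _ _
rightLosing′-closed huge (snd (snd star))       = hugeReply _ _ _
rightLosing′-closed over (fst ())
rightLosing′-closed over (snd (fst (centre ¬ended))) = contradiction refl ¬ended
rightLosing′-closed over (snd (snd ()))

starVsStar≈ : ∀ G H {a b c e} → Models Star G (suc a , b , c) →
              Models (Star ⊕ˢ Ups) H ((suc a , b , 0) , (0 , e)) → Even (c + e) → G ≈ H
starVsStar≈ G H M N ev =
    leftLoses  StarVsStar LeftLosing′  leftLosing′-closed  (G ⊕ ⊝ H) M′ (balanced ev)
  , rightLoses StarVsStar RightLosing′ rightLosing′-closed (G ⊕ ⊝ H) M′ (balanced ev)
  where M′ = models-⊕ Star (⊝ˢ (Star ⊕ˢ Ups)) G (⊝ H) M (models-⊝ (Star ⊕ˢ Ups) H N)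

-- The domination game on a star

bump : Color → Counts → Counts
bump A (a , b , c) = suc a , b , c
bump B (a , b , c) = a , suc b , c
bump C (a , b , c) = a , b , suc c

bump-comm : ∀ x y s → bump x (bump y s) ≡ bump y (bump x s)
bump-comm A A _ = refl
bump-comm A B _ = refl
bump-comm A C _ = refl
bump-comm B A _ = refl
bump-comm B B _ = refl
bump-comm B C _ = refl
bump-comm C A _ = refl
bump-comm C B _ = refl
bump-comm C C _ = refl

bump≢ended : ∀ x {s} → bump x s ≢ ended
bump≢ended A ()
bump≢ended B ()
bump≢ended C ()

bump-injective : ∀ x {s t} → bump x s ≡ bump x t → s ≡ t
bump-injective A refl = refl
bump-injective B refl = refl
bump-injective C refl = refl

-- The two bumps act on different coordinates, so coordinate `y` of `s` is already positive. This
-- lets the search for a leaf of one colour skip leaves of the others.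
bump-≢ : ∀ {x y} → x ≢ y → ∀ s {t} → bump x s ≡ bump y t → ∃[ s′ ] s ≡ bump y s′
bump-≢ {A} {A} x≢y _ _ = contradiction refl x≢y
bump-≢ {B} {B} x≢y _ _ = contradiction refl x≢y
bump-≢ {C} {C} x≢y _ _ = contradiction refl x≢y
bump-≢ {A} {B} _ (_ , suc _ , _) refl = _ , refl
bump-≢ {A} {C} _ (_ , _ , suc _) refl = _ , refl
bump-≢ {B} {A} _ (suc _ , _ , _) refl = _ , refl
bump-≢ {B} {C} _ (_ , _ , suc _) refl = _ , refl
bump-≢ {C} {A} _ (suc _ , _ , _) refl = _ , refl
bump-≢ {C} {B} _ (_ , suc _ , _) refl = _ , refl

remaining : (xs : List Color) → Subset (length xs) → Counts
remaining []       []            = ended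
remaining (x ∷ xs) (outside ∷ T) = bump x (remaining xs T)
remaining (x ∷ xs) (inside ∷ T)  = remaining xs T

-- Stated with `bump` on the earlier position, rather than a decrement on the later one, to fit the
-- sources of leaf moves.
remaining-select : ∀ xs T {i} → i ∉ T →
                   remaining xs T ≡ bump (lookup xs i) (remaining xs (T ∪ ⁅ i ⁆))
remaining-select (x ∷ xs) (inside ∷ T)  {zero}  i∉T = contradiction here i∉T
remaining-select (x ∷ xs) (outside ∷ T) {zero}  i∉T =
  cong (bump x ∘ remaining xs) (sym (∪-identityʳ T))
remaining-select (x ∷ xs) (inside ∷ T)  {suc i} i∉T = remaining-select xs T (i∉T ∘ there)
remaining-select (x ∷ xs) (outside ∷ T) {suc i} i∉T =
  trans (cong (bump x) (remaining-select xs T (i∉T ∘ there))) (bump-comm x (lookup xs i) _)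

∉⇒remaining≢ended : ∀ xs T {i} → i ∉ T → remaining xs T ≢ ended
∉⇒remaining≢ended xs T i∉T eq = bump≢ended _ (trans (sym (remaining-select xs T i∉T)) eq)

remaining≢ended⇒∉ : ∀ xs T → remaining xs T ≢ ended → ∃[ i ] i ∉ T
remaining≢ended⇒∉ []       []            ≢ended = contradiction refl ≢ended
remaining≢ended⇒∉ (x ∷ xs) (outside ∷ T) _      = zero , λ ()
remaining≢ended⇒∉ (x ∷ xs) (inside ∷ T)  ≢ended =
  let i , i∉T = remaining≢ended⇒∉ xs T ≢ended in suc i , λ { (there i∈T) → i∉T i∈T }

remaining-pick : ∀ x xs T {s} → remaining xs T ≡ bump x s →
                 ∃[ i ] i ∉ T × lookup xs i ≡ x × remaining xs (T ∪ ⁅ i ⁆) ≡ s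
remaining-pick x xs T {s} eq = let i , i∉T , eq′ = pick xs T eq in i , i∉T , eq′ , next xs T i∉T eq′ eq
  where
  pick : ∀ xs T {s} → remaining xs T ≡ bump x s → ∃[ i ] i ∉ T × lookup xs i ≡ x
  pick []       []            eq = contradiction (sym eq) (bump≢ended x)
  pick (y ∷ xs) (inside ∷ T)  eq =
    let i , i∉T , eq′ = pick xs T eq in suc i , (λ { (there i∈T) → i∉T i∈T }) , eq′
  pick (y ∷ xs) (outside ∷ T) eq with y ≟ᶜ x
  ... | yes y≡x = zero , (λ ()) , y≡x
  ... | no  y≢x =
    let _ , eq₁ = bump-≢ y≢x (remaining xs T) eq
        i , i∉T , eq′ = pick xs T eq₁
    in suc i , (λ { (there i∈T) → i∉T i∈T }) , eq′

  next : ∀ xs T {i s} → i ∉ T → lookup xs i ≡ x → remaining xs T ≡ bump x s →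
         remaining xs (T ∪ ⁅ i ⁆) ≡ s
  next xs T i∉T refl eq = bump-injective x (trans (sym (remaining-select xs T i∉T)) eq)

leafMoveᴸ : ∀ {x s} → AliceMay x → StarMoveᴸ (bump x s) s
leafMoveᴸ (inj₁ refl) = leafA
leafMoveᴸ (inj₂ refl) = leafC

leafMoveᴿ : ∀ {x s} → BobMay x → StarMoveᴿ (bump x s) s
leafMoveᴿ (inj₁ refl) = leafB
leafMoveᴿ (inj₂ refl) = leafC

-- The leaf `i₀` excludes the one-vertex graph, whose centre is playable although its counts are
-- `ended`. With a leaf present, selecting all leaves dominates the centre.
module _ (xs : List Color) (i₀ : Fin (length xs)) where
  open Domination (K₁ (length xs)) (starColoring A xs)

  counts : Subset (suc (length xs)) → Counts
  counts (inside ∷ T)  = ended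
  counts (outside ∷ T) = remaining xs T

  centre-dominates : ∀ v → Dominates zero v
  centre-dominates zero    = inj₁ refl
  centre-dominates (suc _) = inj₂ _

  ¬playable-ended : ∀ {T u} → ¬ Playable (inside ∷ T) u
  ¬playable-ended (v , _ , ¬dom) = ¬dom (zero , here , centre-dominates v)

  -- Only the leaf itself and the centre dominate a leaf, and the centre is `outside`.
  undominated-leaf : ∀ {T i} → i ∉ T → ¬ DominatedBy (outside ∷ T) (suc i)
  undominated-leaf i∉T (suc _ , there i∈T , inj₁ refl) = i∉T i∈T

  playable-leaf : ∀ {T i} → i ∉ T → Playable (outside ∷ T) (suc i)
  playable-leaf i∉T = _ , inj₁ refl , undominated-leaf i∉T

  playable-leaf⇒∉ : ∀ {T i} → Playable (outside ∷ T) (suc i) → i ∉ T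
  playable-leaf⇒∉ (v , i▸v , ¬dom) i∈T = ¬dom (_ , there i∈T , i▸v)

  playable-centre : ∀ {T} → remaining xs T ≢ ended → Playable (outside ∷ T) zero
  playable-centre {T} ≢ended =
    let i , i∉T = remaining≢ended⇒∉ xs T ≢ended in suc i , inj₂ _ , undominated-leaf i∉T

  playable-centre⇒≢ended : ∀ {T} → Playable (outside ∷ T) zero → remaining xs T ≢ ended
  playable-centre⇒≢ended {T} (zero , _ , ¬dom) =
    ∉⇒remaining≢ended xs T {i₀} λ i₀∈T → ¬dom (suc i₀ , there i₀∈T , inj₂ _)
  playable-centre⇒≢ended {T} (suc i , _ , ¬dom) =
    ∉⇒remaining≢ended xs T {i} λ i∈T → ¬dom (suc i , there i∈T , inj₁ refl)

  models-position : ∀ S (rec : Acc _⊃_ S) → Models Star (position S rec) (counts S)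
  models-position (inside ∷ T) (acc rs) =
      (λ (_ , _ , p) → ⊥-elim (¬playable-ended p))
    , (λ { (centre ¬ended) → contradiction refl ¬ended })
    , (λ (_ , _ , p) → ⊥-elim (¬playable-ended p))
    , (λ ())
  models-position S@(outside ∷ T) (acc rs) = fromL , toL refl , fromR , toR refl
    where
    option : ∀ {u} → Playable S u → Game
    option {u} p = position (S ∪ ⁅ u ⁆) (rs (playable⇒⊃ S u p))

    models-option : ∀ {u} (p : Playable S u) → Models Star (option p) (counts (S ∪ ⁅ u ⁆))
    models-option {u} p = models-position (S ∪ ⁅ u ⁆) (rs (playable⇒⊃ S u p))

    fromL : ((u , _ , p) : AliceMove S) → ∃[ t ] StarMoveᴸ (remaining xs T) t × Models Star (option p) t
    fromL (zero , _ , p) = _ , centre (playable-centre⇒≢ended p) , models-option p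
    fromL (suc i , may , p) =
      _ , subst (λ s → StarMoveᴸ s (remaining xs (T ∪ ⁅ i ⁆)))
            (sym (remaining-select xs T (playable-leaf⇒∉ p))) (leafMoveᴸ may)
        , models-option p

    fromR : ((u , _ , p) : BobMove S) → ∃[ t ] StarMoveᴿ (remaining xs T) t × Models Star (option p) t
    fromR (zero , inj₁ () , p)
    fromR (zero , inj₂ () , p)
    fromR (suc i , may , p) =
      _ , subst (λ s → StarMoveᴿ s (remaining xs (T ∪ ⁅ i ⁆)))
            (sym (remaining-select xs T (playable-leaf⇒∉ p))) (leafMoveᴿ may)
        , models-option p

    leaf : ∀ x {t} (May : Color → Set) → May x → remaining xs T ≡ bump x t →
           Σ[ (u , _ , p) ∈ ∃[ u ] May (starColoring A xs u) × Playable S u ] Models Star (option p) t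
    leaf x {t} May may eq =
      let i , i∉T , eq₁ , eq₂ = remaining-pick x xs T eq
          p = playable-leaf i∉T
      in (suc i , subst May (sym eq₁) may , p) , subst (Models Star (option p)) eq₂ (models-option p)

    -- The source is a variable `s` tied by an equation, because a move cannot be matched against
    -- the stuck index `remaining xs T`.
    toL : ∀ {s t} → remaining xs T ≡ s → StarMoveᴸ s t → Σ[ (_ , _ , p) ∈ AliceMove S ] Models Star (option p) t
    toL eq (centre ≢ended) =
      let p = playable-centre (≢ended ∘ trans (sym eq)) in (zero , inj₁ refl , p) , models-option p
    toL eq leafA           = leaf A AliceMay (inj₁ refl) eq
    toL eq leafC           = leaf C AliceMay (inj₂ refl) eq

    toR : ∀ {s t} → remaining xs T ≡ s → StarMoveᴿ s t → Σ[ (_ , _ , p) ∈ BobMove S ] Models Star (option p) t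
    toR eq leafB = leaf B BobMay (inj₁ refl) eq
    toR eq leafC = leaf C BobMay (inj₂ refl) eq

-- Colour counts of the starting position.

tally : List Color → Counts
tally xs = remaining xs Subset.⊥

tally-# : ∀ xs → tally xs ≡ (#[ A ] xs , #[ B ] xs , #[ C ] xs)
tally-# []       = refl
tally-# (A ∷ xs) = cong (bump A) (tally-# xs)
tally-# (B ∷ xs) = cong (bump B) (tally-# xs)
tally-# (C ∷ xs) = cong (bump C) (tally-# xs)

tally-removeC : ∀ xs → tally (removeC xs) ≡ (#[ A ] xs , #[ B ] xs , 0)
tally-removeC []       = refl
tally-removeC (A ∷ xs) = cong (bump A) (tally-removeC xs)
tally-removeC (B ∷ xs) = cong (bump B) (tally-removeC xs)
tally-removeC (C ∷ xs) = tally-removeC xs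

length-# : ∀ xs → length xs ≡ #[ A ] xs + (#[ B ] xs + #[ C ] xs)
length-# []       = refl
length-# (A ∷ xs) = cong suc (length-# xs)
length-# (B ∷ xs) = trans (cong suc (length-# xs)) (sym (+-suc (#[ A ] xs) _))
length-# (C ∷ xs) = trans (cong suc (length-# xs))
  (sym (trans (cong (#[ A ] xs +_) (+-suc (#[ B ] xs) _)) (+-suc (#[ A ] xs) _)))

models-starGame : ∀ xs {s} → tally xs ≡ s → s ≢ ended → Models Star (starGame A xs) s
models-starGame xs refl ≢ended =
  models-position xs (proj₁ (remaining≢ended⇒∉ xs Subset.⊥ ≢ended)) Subset.⊥ (⊃-wellFounded Subset.⊥)

-- Interchanging the colours A and B

module _ {n} (G : Graph n) (κ : Coloring n) where
  open Domination G κ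

  -- The states keep the exact selected set, because the strategy below copies individual vertices.
  Selections : System
  Selections = record
    { State = Subset n
    ; _⟶ᴸ_  = λ S T → Σ[ (u , _) ∈ AliceMove S ] T ≡ S ∪ ⁅ u ⁆
    ; _⟶ᴿ_  = λ S T → Σ[ (u , _) ∈ BobMove S ] T ≡ S ∪ ⁅ u ⁆
    }

  models-selections : ∀ S (rec : Acc _⊃_ S) → Models Selections (position S rec) S
  models-selections S (acc rs) =
      (λ m@(_ , _ , p) → _ , (m , refl) , models-selections _ (rs (playable⇒⊃ S _ p)))
    , (λ { (m@(_ , _ , p) , refl) → m , models-selections _ (rs (playable⇒⊃ S _ p)) })
    , (λ m@(_ , _ , p) → _ , (m , refl) , models-selections _ (rs (playable⇒⊃ S _ p)))
    , (λ { (m@(_ , _ , p) , refl) → m , models-selections _ (rs (playable⇒⊃ S _ p)) })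

alice⇒bob : ∀ {x} → AliceMay x → BobMay (swapAB x)
alice⇒bob (inj₁ refl) = inj₁ refl
alice⇒bob (inj₂ refl) = inj₂ refl

bob⇒alice : ∀ {x} → BobMay x → AliceMay (swapAB x)
bob⇒alice (inj₁ refl) = inj₁ refl
bob⇒alice (inj₂ refl) = inj₂ refl

swapAB-involutive : ∀ x → swapAB (swapAB x) ≡ x
swapAB-involutive A = refl
swapAB-involutive B = refl
swapAB-involutive C = refl

module _ {n} (G : Graph n) (κ : Coloring n) where
  private
    game₁ = dominationGame G κ
    game₂ = dominationGame G (swapAB ∘ κ)

    𝓣 : System
    -- The double negation is the one produced by unfolding `game₁ ≈ ⊝ game₂`.
    𝓣 = Selections G κ ⊕ˢ ⊝ˢ ⊝ˢ Selections G (swapAB ∘ κ)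

    data Same : System.State 𝓣 → Set where
      same : ∀ {S} → Same (S , S)

    unswapᴬ : ∀ u → BobMay (swapAB (κ u)) → AliceMay (κ u)
    unswapᴬ u = subst AliceMay (swapAB-involutive (κ u)) ∘ bob⇒alice

    unswapᴮ : ∀ u → AliceMay (swapAB (κ u)) → BobMay (κ u)
    unswapᴮ u = subst BobMay (swapAB-involutive (κ u)) ∘ alice⇒bob

    rightCopies : ∀ {s t} → Same s → System._⟶ᴸ_ 𝓣 s t → RightReplies 𝓣 Same t
    rightCopies same (fst ((u , may , p) , refl)) = _ , snd ((u , alice⇒bob may , p) , refl) , same
    rightCopies same (snd ((u , may , p) , refl)) = _ , fst ((u , unswapᴮ u may , p) , refl) , same

    leftCopies : ∀ {s t} → Same s → System._⟶ᴿ_ 𝓣 s t → LeftReplies 𝓣 Same t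
    leftCopies same (fst ((u , may , p) , refl)) = _ , snd ((u , bob⇒alice may , p) , refl) , same
    leftCopies same (snd ((u , may , p) , refl)) = _ , fst ((u , unswapᴬ u may , p) , refl) , same

  -- The second player selects the same vertex in the other component. Playability ignores colours,
  -- so the same proof `p` serves there, and the swap makes the vertex legal for the opponent of the
  -- player who chose it first.
  dominationGame≈⊝swapped : game₁ ≈ ⊝ game₂
  dominationGame≈⊝swapped =
      leftLoses  𝓣 Same rightCopies (game₁ ⊕ ⊝ ⊝ game₂) M same
    , rightLoses 𝓣 Same leftCopies  (game₁ ⊕ ⊝ ⊝ game₂) M same
    where
    wf = ⊃-wellFounded Subset.⊥
    M = models-⊕ _ _ game₁ (⊝ ⊝ game₂) (models-selections G κ _ wf)
          (models-⊝ _ (⊝ game₂) (models-⊝ _ game₂ (models-selections G (swapAB ∘ κ) _ wf)))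

theorem8 : (leaves : List Color) →
    let n = length leaves
        a = #[ A ] leaves
        c = #[ C ] leaves
        J = starGame A (removeC leaves)
    in c ≥ 1 →
       (a ≡ 0 → (2 ∣ n → starGame A leaves ≈ (n ∸ 1) · ↑)
              × (2 ∤ n → starGame A leaves ≈ (n ∸ 1) · ↑ ⊕ ⋆))
     × (a > 0 → (2 ∣ c → starGame A leaves ≈ J)
              × (2 ∤ c → starGame A leaves ≈ J ⊕ ⋆))
     × (starGame B leaves ≈ ⊝ swappedStarGame B leaves)
theorem8 leaves c≥1 =
    (λ a≡0 → infinitesimal (tally-# leaves) (length-# leaves) a≡0 c≥1)
  , numberlike (tally-# leaves) (tally-removeC leaves)
  , dominationGame≈⊝swapped (K₁ (length leaves)) (starColoring B leaves)
  where
  G = starGame A leaves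
  J = starGame A (removeC leaves)
  n = length leaves

  -- The counts become variables so that `a ≡ 0` can be matched; `c ≥ 1` then shows that the
  -- starting state is not `ended`.
  infinitesimal : ∀ {a b c} → tally leaves ≡ (a , b , c) → n ≡ a + (b + c) → a ≡ 0 → c ≥ 1 →
                  (2 ∣ n → G ≈ (n ∸ 1) · ↑) × (2 ∤ n → G ≈ (n ∸ 1) · ↑ ⊕ ⋆)
  infinitesimal {b = b} {suc c} eq n≡ refl _ =
      (λ 2∣n → starVsUps≈ G _ M (models-· (n ∸ 1)) (cong (_∸ 1) n≡)
                 (subst Even (trans n≡ (sym (+-identityʳ _))) (2∣⇒even 2∣n)))
    , (λ 2∤n → starVsUps≈ G _ M (models-·⊕⋆ (n ∸ 1)) (cong (_∸ 1) n≡)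
                 (subst Even (trans (cong suc n≡) (sym (+-comm _ 1))) (suc (2∤⇒odd 2∤n))))
    where M = models-starGame leaves eq λ ()

  numberlike : ∀ {a b c} → tally leaves ≡ (a , b , c) → tally (removeC leaves) ≡ (a , b , 0) →
               a > 0 → (2 ∣ c → G ≈ J) × (2 ∤ c → G ≈ J ⊕ ⋆)
  numberlike {suc a} {b} {c} eqG eqJ _ =
      (λ 2∣c → starVsStar≈ G J M
                 -- `J` is padded with an empty sum of `↑` and `⋆`, so that one comparison serves
                 -- both parities of `c`, with `e` equal to 0 or 1.
                 (models-map Star (Star ⊕ˢ Ups) (_, (0 , 0)) fst noStarᴸ fst noStarᴿ J N)
                 (subst Even (sym (+-identityʳ c)) (2∣⇒even 2∣c)))
    , (λ 2∤c → starVsStar≈ G (J ⊕ ⋆) M (models-⊕ Star Ups J ⋆ N models-⋆)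
                 (subst Even (+-comm 1 c) (suc (2∤⇒odd 2∤c))))
    where
    M = models-starGame leaves eqG λ ()
    N = models-starGame (removeC leaves) eqJ λ ()

    noStarᴸ : ∀ s {t} → System._⟶ᴸ_ (Star ⊕ˢ Ups) (s , (0 , 0)) t →
              ∃[ s′ ] StarMoveᴸ s s′ × (s′ , (0 , 0)) ≡ t
    noStarᴸ s (fst m) = _ , m , refl

    noStarᴿ : ∀ s {t} → System._⟶ᴿ_ (Star ⊕ˢ Ups) (s , (0 , 0)) t →
              ∃[ s′ ] StarMoveᴿ s s′ × (s′ , (0 , 0)) ≡ t
    noStarᴿ s (fst m) = _ , m , refl
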